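{- Let $a\ge2$, let $t\ge3$ be odd, and let $F=\breve F(a^t)$, where $a^t$ is the $t$-tuple $(a,\dots,a)$, with $n=\#F$. Then \[ \hat\chi\equiv\frac n2+a\Big(\sum_{p\text{ peak}}\chi_p-\sum_{v\text{ valley}}\chi_v\Big), \] where $\hat\chi=\sum_{q\in F}\hat\chi_q$ is the order ideal cardinality statistic.
   Context: A fence $\breve F(\alpha_1,\dots,\alpha_t)$ ($t\ge2$, positive integers, $\alpha_1,\alpha_t\ge2$) is the poset on $\{x_1,\dots,x_n\}$, $n=\alpha_1+\dots+\alpha_t-1$, with $a_i=\alpha_1+\dots+\alpha_i$, $a_0=0$, whose cover relations are: for $1\le j\le n-1$ with $a_{i-1}\le j<a_i$, $x_j\lessdot x_{j+1}$ if $i$ odd and $x_j\gtrdot x_{j+1}$ if $i$ even. The elements $x_{a_i}$, $i\in[t-1]$, are peaks (cover two elements, $i$ odd) or valleys (covered by two elements, $i$ even). $\mathcal J(F)$ is the set of order ideals. For $q\in F$, $I\in\mathcal J(F)$: $\hat\chi_q(I)=1$ if $q\in I$, else 0; $\chi_q(I)=1$ if $q\in\max(I)$, else 0; $T_q(I)=1$ if $q\in\min(F\setminus I)$, $-1$ if $q\in\max(I)$, $0$ otherwise. $f\equiv g$ means $f-g=\sum_{q\in F}c_qT_q$ for real constants $c_q$; real numbers denote constant functions. -}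

module Defs where

open import Algebra.Definitions.RawMonoid using (sum)
open import Data.Bool.Base using (if_then_else_)
open import Data.Fin.Base using (Fin; toℕ)
open import Data.Fin.Properties using (any?; _≟_)
open import Data.Fin.Subset using (Subset; _∈_; _∉_)
open import Data.Fin.Subset.Properties using (_∈?_)
import Data.List.Base as List
open import Data.Nat.Base as ℕ using (ℕ; suc; parity)
open import Data.Nat.ListAction using () renaming (sum to sum𝕃)
import Data.Nat.Properties as ℕ
open import Data.Parity.Base using (0ℙ; 1ℙ)
import Data.Parity.Properties as ℙ
open import Data.Product.Base using (Σ-syntax; _×_; _,_)
open import Data.Rational.Base using (ℚ; 0ℚ; 1ℚ; _-_; _*_; -_; +-0-rawMonoid)
open import Data.Sum.Base using (_⊎_)
open import Data.Vec.Base as Vec using (Vec)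
open import Level using (0ℓ)
open import Relation.Binary.Core using (Rel)
open import Relation.Binary.Definitions using (Decidable)
open import Relation.Binary.Construct.Closure.ReflexiveTransitive using (Star; ε; _◅_)
open import Relation.Binary.PropositionalEquality using (_≡_; refl)
open import Relation.Nullary.Decidable using (Dec; yes; no; does; ¬?; _×-dec_; _⊎-dec_)
open import Relation.Nullary.Negation using (contradiction)
import Relation.Unary as U

Σℚ : {n : ℕ} → (Fin n → ℚ) → ℚ
Σℚ = sum +-0-rawMonoid

indicator : {P : Set} → Dec P → ℚ
indicator P? = if does P? then 1ℚ else 0ℚ

-- The order on Fin n is the reflexive-transitive closure of _⋖_.
module OrderIdeals {n : ℕ} (_⋖_ : Rel (Fin n) 0ℓ) (_⋖?_ : Decidable _⋖_) where

  infix 4 _≤_ _∈max_ _∈max?_ _∈min∁_ _∈min∁?_ _≋_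

  _≤_ : Rel (Fin n) 0ℓ
  _≤_ = Star _⋖_

  record Ideal : Set where
    field
      members    : Subset n
      downClosed : ∀ {q r} → q ≤ r → r ∈ members → q ∈ members

  open Ideal public

  _∈max_ : Fin n → Ideal → Set
  q ∈max I = q ∈ members I × (∀ r → r ∈ members I → q ≤ r → q ≡ r)

  -- q is a minimal element of the complement of I.
  _∈min∁_ : Fin n → Ideal → Set
  q ∈min∁ I = q ∉ members I × (∀ r → r ∉ members I → r ≤ q → r ≡ q)

  -- To decide either property it suffices, I being an ideal, to search among
  -- the _⋖_-neighbours of q.
  _∈max?_ : Decidable _∈max_
  q ∈max? I with q ∈? members I
  ... | no  q∉I = no λ (q∈I , _) → q∉I q∈I
  ... | yes q∈I with any? (λ s → (q ⋖? s) ×-dec (s ∈? members I) ×-dec ¬? (q ≟ s))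
  ...   | yes (s , q⋖s , s∈I , q≢s) = no λ (_ , top) → q≢s (top s s∈I (q⋖s ◅ ε))
  ...   | no  none = yes (q∈I , λ r → top)
    where
    top : ∀ {r} → r ∈ members I → q ≤ r → q ≡ r
    top r∈I ε = refl
    top r∈I (_◅_ {j = s} q⋖s s≤r) with q ≟ s
    ... | yes refl = top r∈I s≤r
    ... | no  q≢s  = contradiction (s , q⋖s , downClosed I s≤r r∈I , q≢s) none

  _∈min∁?_ : Decidable _∈min∁_
  q ∈min∁? I with q ∈? members I
  ... | yes q∈I = no λ (q∉I , _) → q∉I q∈I
  ... | no  q∉I with any? (λ s → (s ⋖? q) ×-dec ¬? (s ∈? members I) ×-dec ¬? (s ≟ q))
  ...   | yes (s , s⋖q , s∉I , s≢q) = no λ (_ , bot) → s≢q (bot s s∉I (s⋖q ◅ ε))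
  ...   | no  none = yes (q∉I , λ r → bot)
    where
    bot : ∀ {r} → r ∉ members I → r ≤ q → r ≡ q
    bot r∉I ε = refl
    bot {r} r∉I (r⋖s ◅ s≤q) with bot (λ s∈I → r∉I (downClosed I (r⋖s ◅ ε) s∈I)) s≤q
    ... | refl with r ≟ q
    ...   | yes r≡q = r≡q
    ...   | no  r≢q = contradiction (r , r⋖s , r∉I , r≢q) none

  Statistic : Set
  Statistic = Ideal → ℚ

  χ̂ : Fin n → Statistic
  χ̂ q I = indicator (q ∈? members I)

  χ : Fin n → Statistic
  χ q I = indicator (q ∈max? I)

  T : Fin n → Statistic
  T q I = if does (q ∈min∁? I) then 1ℚ else if does (q ∈max? I) then - 1ℚ else 0ℚ

  -- Equality modulo the span of the T q.  For rational-valued statistics this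
  -- is the same relation whether the coefficients c q range over ℚ or over ℝ,
  -- as a finite rational linear system solvable over ℝ is solvable over ℚ.
  _≋_ : Rel Statistic 0ℓ
  f ≋ g = Σ[ c ∈ (Fin n → ℚ) ] (∀ I → f I - g I ≡ Σℚ (λ q → c q * T q I))

-- The fence on α = (α₁, …, αₜ); it is meant for t ≥ 2, positive αᵢ, and
-- α₁, αₜ ≥ 2.
module Fence {t : ℕ} (α : Vec ℕ t) where

  -- a i = α₁ + … + αᵢ
  a : ℕ → ℕ
  a i = sum𝕃 (List.take i (Vec.toList α))

  #F : ℕ
  #F = Vec.sum α ℕ.∸ 1

  F : Set
  F = Fin #F

  -- The element q : F is the one written x_j with j = index q.
  index : F → ℕ
  index q = suc (toℕ q)

  -- The index i ∈ {1, …, t} is represented by k : Fin t with i = suc (toℕ k).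
  -- x_j and x_{j+1} lie on segment i exactly when a (i - 1) ≤ j < a i.
  OnSegment : ℕ → Fin t → Set
  OnSegment j k = a (toℕ k) ℕ.≤ j × j ℕ.< a (suc (toℕ k))

  Odd Even : U.Pred ℕ 0ℓ
  Odd  i = parity i ≡ 1ℙ
  Even i = parity i ≡ 0ℙ

  infix 4 _⋖_ _⋖?_

  _⋖_ : Rel F 0ℓ
  p ⋖ q = Σ[ k ∈ Fin t ]
    ( (Odd  (suc (toℕ k)) × OnSegment (index p) k × index q ≡ suc (index p))
    ⊎ (Even (suc (toℕ k)) × OnSegment (index q) k × index p ≡ suc (index q)) )

  onSegment? : Decidable OnSegment
  onSegment? j k = (a (toℕ k) ℕ.≤? j) ×-dec (j ℕ.<? a (suc (toℕ k)))

  odd? : U.Decidable Odd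
  odd? i = parity i ℙ.≟ 1ℙ

  even? : U.Decidable Even
  even? i = parity i ℙ.≟ 0ℙ

  _⋖?_ : Decidable _⋖_
  p ⋖? q = any? λ k →
    (odd? (suc (toℕ k)) ×-dec onSegment? (index p) k ×-dec (index q ℕ.≟ suc (index p)))
    ⊎-dec
    (even? (suc (toℕ k)) ×-dec onSegment? (index q) k ×-dec (index p ℕ.≟ suc (index q)))

  open OrderIdeals _⋖_ _⋖?_ public

  -- Here i ranges over {1, …, t - 1}.
  Peak Valley : U.Pred F 0ℓ
  Peak   q = Σ[ i ∈ Fin t ] (1 ℕ.≤ toℕ i × Odd  (toℕ i) × index q ≡ a (toℕ i))
  Valley q = Σ[ i ∈ Fin t ] (1 ℕ.≤ toℕ i × Even (toℕ i) × index q ≡ a (toℕ i))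

  peak? : U.Decidable Peak
  peak? q = any? λ i →
    (1 ℕ.≤? toℕ i) ×-dec odd? (toℕ i) ×-dec (index q ℕ.≟ a (toℕ i))

  valley? : U.Decidable Valley
  valley? q = any? λ i →
    (1 ℕ.≤? toℕ i) ×-dec even? (toℕ i) ×-dec (index q ℕ.≟ a (toℕ i))

  cardinality : Statistic
  cardinality I = Σℚ (λ q → χ̂ q I)

  Σpeak Σvalley : (F → Statistic) → Statistic
  Σpeak   f I = Σℚ (λ q → if does (peak?   q) then f q I else 0ℚ)
  Σvalley f I = Σℚ (λ q → if does (valley? q) then f q I else 0ℚ)

{-# OPTIONS --safe #-}
module Submission where

-- Let X_j indicate x_j ∈ I, with X_0 = 1 and X_{n+1} = 0; this fits, as the first
-- and the last segment rise.  At an element that is neither a peak nor a valley,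
-- T_j = X_{j-1} - 2 X_j + X_{j+1}; at a peak χ_j = X_j; at a valley
-- T_j + χ_j = 1 - X_j.  Let D_j = -r (a - r) / 2 with r = j mod a: its second
-- difference is 1 off the multiples of a and 1 - a at them.  With coefficients 0 at
-- peaks, -a at valleys and D_j elsewhere, the contribution of x_j to
--   χ̂ - a (Σ χ_p - Σ χ_v) - Σ c_q T_q
-- is X_j (Δ²D)_j - D_j (Δ²X)_j, plus a at a valley.  The first two terms are the
-- increment of the discrete Wronskian X_j D_{j+1} - D_j X_{j+1}, so the sum telescopes.

open import Defs
open import Data.Bool.Base using (Bool; true; false; if_then_else_)
import Data.Bool.Properties as Bool
open import Data.Empty using (⊥)
open import Data.Fin.Base using (Fin; toℕ; fromℕ<)
open import Data.Fin.Properties using (toℕ-fromℕ<; toℕ<n)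
open import Data.Fin.Subset using (Subset; inside; outside; _∈_; _∉_)
open import Data.Fin.Subset.Properties using (_∈?_)
open import Data.Integer.Base as ℤ using (+_)
import Data.Integer.Properties as ℤ
import Data.List.Base as List
open import Data.Nat.Base as ℕ using (ℕ; zero; suc; parity; _≤_; _<_; z≤n; s≤s; ⌊_/2⌋)
open import Data.Nat.Divisibility using (n∣m*n)
open import Data.Nat.DivMod
  using (_%_; m*n/n≡m; m<n⇒m/n≡0; +-distrib-/-∣ʳ; [m+kn]%n≡m%n; m<n⇒m%n≡m; m≡m%n+[m/n]*n; m%n<n; m<n*o⇒m/o<n; m/n*n≤m)
open import Data.Nat.ListAction using () renaming (sum to sum𝕃)
import Data.Nat.Properties as ℕ
open import Data.Parity.Base as ℙ using (Parity; 0ℙ; 1ℙ)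
import Data.Parity.Properties as ℙ
open import Data.Product.Base using (Σ-syntax; _×_; _,_; proj₁)
open import Data.Rational.Base as ℚ using (ℚ; 0ℚ; 1ℚ; ½; -_; _/_; _+_; _-_; _*_)
import Data.Rational.Properties as ℚ
open import Data.Rational.Solver using (module +-*-Solver)
import Data.Rational.Unnormalised.Base as ℚᵘ
import Data.Rational.Unnormalised.Properties as ℚᵘ
open import Data.Sum.Base using (_⊎_; inj₁; inj₂)
open import Data.Vec.Base as Vec using (Vec; []; _∷_; replicate)
open import Function.Base using (_∘_)
open import Function.Bundles using (_⇔_; mk⇔)
open import Relation.Binary.Construct.Closure.ReflexiveTransitive using (ε; _◅_)
open import Relation.Binary.PropositionalEquality
  using (_≡_; refl; sym; trans; cong; cong₂; subst; module ≡-Reasoning)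
open import Relation.Nullary.Decidable
  using (Dec; yes; no; does; does-⇔; _×-dec_; _→-dec_; dec-true; dec-false)

open +-*-Solver using (solve; con; _:=_; _:+_; _:-_; _:*_; :-_)

-- Sums, parity and halving of natural numbers.

vecSum-replicate : ∀ t a → Vec.sum (replicate t a) ≡ t ℕ.* a
vecSum-replicate zero    a = refl
vecSum-replicate (suc t) a = cong (a ℕ.+_) (vecSum-replicate t a)

sum-take-replicate : ∀ {i t} a → i ≤ t →
  sum𝕃 (List.take i (Vec.toList (replicate t a))) ≡ i ℕ.* a
sum-take-replicate a z≤n       = refl
sum-take-replicate a (s≤s i≤t) = cong (a ℕ.+_) (sum-take-replicate a i≤t)

parity-suc : ∀ k → parity (suc k) ≡ parity k ℙ.⁻¹
parity-suc zero          = refl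
parity-suc (suc zero)    = refl
parity-suc (suc (suc k)) = parity-suc k

⌊suc/2⌋-even : ∀ k → parity k ≡ 0ℙ → ⌊ suc k /2⌋ ≡ ⌊ k /2⌋
⌊suc/2⌋-even zero          _  = refl
⌊suc/2⌋-even (suc (suc k)) ek = cong suc (⌊suc/2⌋-even k ek)

⌊suc/2⌋-odd : ∀ k → parity k ≡ 1ℙ → ⌊ suc k /2⌋ ≡ suc ⌊ k /2⌋
⌊suc/2⌋-odd (suc zero)    _  = refl
⌊suc/2⌋-odd (suc (suc k)) ok = cong suc (⌊suc/2⌋-odd k ok)

even⇒≡⌊/2⌋+⌊/2⌋ : ∀ k → parity k ≡ 0ℙ → k ≡ ⌊ k /2⌋ ℕ.+ ⌊ k /2⌋
even⇒≡⌊/2⌋+⌊/2⌋ zero          _  = refl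
even⇒≡⌊/2⌋+⌊/2⌋ (suc (suc k)) ek =
  cong suc (trans (cong suc (even⇒≡⌊/2⌋+⌊/2⌋ k ek)) (sym (ℕ.+-suc ⌊ k /2⌋ ⌊ k /2⌋)))

-- Subsets as Boolean sequences.

at : ∀ {n} → Vec Bool n → ℕ → Bool
at []       _       = false
at (b ∷ bs) zero    = b
at (b ∷ bs) (suc j) = at bs j

at-∈? : ∀ {n} (q : Fin n) (S : Subset n) → does (q ∈? S) ≡ at S (toℕ q)
at-∈? Fin.zero    (inside  ∷ S) = refl
at-∈? Fin.zero    (outside ∷ S) = refl
at-∈? (Fin.suc q) (s ∷ S)       = at-∈? q S

at-bounded : ∀ {n} (S : Subset n) j → at S j ≡ true → j < n
at-bounded (s ∷ S) zero    _ = s≤s z≤n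
at-bounded (s ∷ S) (suc j) e = s≤s (at-bounded S j e)

-- Supplies the convention X_{n+1} = 0 at the right end of the fence.
at-beyond : ∀ {n} (S : Subset n) → at S n ≡ false
at-beyond []      = refl
at-beyond (s ∷ S) = at-beyond S

∈⇒at : ∀ {n} {q : Fin n} {S : Subset n} → q ∈ S → at S (toℕ q) ≡ true
∈⇒at {q = q} {S} q∈S = trans (sym (at-∈? q S)) (dec-true (q ∈? S) q∈S)

∉⇒at : ∀ {n} {q : Fin n} {S : Subset n} → q ∉ S → at S (toℕ q) ≡ false
∉⇒at {q = q} {S} q∉S = trans (sym (at-∈? q S)) (dec-false (q ∈? S) q∉S)

at⇒∈ : ∀ {n} {q : Fin n} {S : Subset n} → at S (toℕ q) ≡ true → q ∈ S
at⇒∈ {q = q} {S} e with q ∈? S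
... | yes q∈S = q∈S
... | no  q∉S with () ← trans (sym e) (∉⇒at q∉S)

at⇒∉ : ∀ {n} {q : Fin n} {S : Subset n} → at S (toℕ q) ≡ false → q ∉ S
at⇒∉ e q∈S with () ← trans (sym e) (∈⇒at q∈S)

-- Toggles and maximality in terms of neighbours.

-- The data u, v, x, y, z describe an element x_j: u and v are the slopes of the
-- edges on its left and right (0ℙ rising, 1ℙ falling), and x, y, z record
-- whether x_{j-1}, x_j, x_{j+1} lie in the ideal.
Maximal Minimal∁ : (u v : Parity) (x y z : Bool) → Set
Maximal  u v x y z = y ≡ true  × (v ≡ 0ℙ → z ≡ false) × (u ≡ 1ℙ → x ≡ false)
Minimal∁ u v x y z = y ≡ false × (u ≡ 0ℙ → x ≡ true)  × (v ≡ 1ℙ → z ≡ true)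

maximal? : ∀ u v x y z → Dec (Maximal u v x y z)
maximal? u v x y z =
  (y Bool.≟ true) ×-dec ((v ℙ.≟ 0ℙ) →-dec (z Bool.≟ false)) ×-dec ((u ℙ.≟ 1ℙ) →-dec (x Bool.≟ false))

minimal∁? : ∀ u v x y z → Dec (Minimal∁ u v x y z)
minimal∁? u v x y z =
  (y Bool.≟ false) ×-dec ((u ℙ.≟ 0ℙ) →-dec (x Bool.≟ true)) ×-dec ((v ℙ.≟ 1ℙ) →-dec (z Bool.≟ true))

bit : Bool → ℚ
bit b = if b then 1ℚ else 0ℚ

toggle : (u v : Parity) (x y z : Bool) → ℚ
toggle u v x y z =
  if does (minimal∁? u v x y z) then 1ℚ else if does (maximal? u v x y z) then - 1ℚ else 0ℚ

-- The patterns that down-closure leaves on an edge of slope `u`: the lower end belongs whenever the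
-- upper end does.
data Edge : Parity → Bool → Bool → Set where
  both    : ∀ {u} → Edge u true true
  neither : ∀ {u} → Edge u false false
  onlyˡ    : Edge 0ℙ true false
  onlyʳ   : Edge 1ℙ false true

-- On a rising stretch the indicator of `Minimal∁` is `bit x - bit y` and that of `Maximal` is
-- `bit y - bit z`; on a falling one `x` and `z` swap. Either way the difference is the same.
toggle-interior : ∀ {u v x y z} → u ≡ v → Edge u x y → Edge v y z →
  toggle u v x y z ≡ bit x - (1ℚ + 1ℚ) * bit y + bit z
toggle-interior {0ℙ} refl both    both    = refl
toggle-interior {1ℙ} refl both    both    = refl
toggle-interior      refl both    onlyˡ    = refl
toggle-interior {0ℙ} refl neither neither = refl
toggle-interior {1ℙ} refl neither neither = refl
toggle-interior      refl neither onlyʳ   = refl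
toggle-interior      refl onlyˡ    neither = refl
toggle-interior      refl onlyʳ   both    = refl

-- Both neighbours lie below a peak, so a peak in the ideal is automatically maximal.
maximal-peak : ∀ {u v x y z} → u ≡ 0ℙ → v ≡ 1ℙ → Edge u x y → Edge v y z →
  bit (does (maximal? u v x y z)) ≡ bit y
maximal-peak refl refl both    both    = refl
maximal-peak refl refl neither neither = refl
maximal-peak refl refl neither onlyʳ   = refl
maximal-peak refl refl onlyˡ    neither = refl
maximal-peak refl refl onlyˡ    onlyʳ   = refl

-- Nothing lies below a valley, so it is minimal in the complement as soon as it is outside the
-- ideal.
toggle-valley : ∀ {u v x y z} → u ≡ 1ℙ → v ≡ 0ℙ → Edge u x y → Edge v y z →
  toggle u v x y z ≡ 1ℚ - bit y - bit (does (maximal? u v x y z))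
toggle-valley refl refl both    both    = refl
toggle-valley refl refl both    onlyˡ    = refl
toggle-valley refl refl neither neither = refl
toggle-valley refl refl onlyʳ   both    = refl
toggle-valley refl refl onlyʳ   onlyˡ    = refl

-- Rational arithmetic and telescoping sums.

ι : ℕ → ℚ
ι n = (+ n) / 1

-- Normalised fractions are stuck on a gcd for variable `n`; the identities below are therefore
-- checked on unnormalised fractions.
toℚᵘ-ι : ∀ n → ℚ.toℚᵘ (ι n) ℚᵘ.≃ ℚᵘ.mkℚᵘ (+ n) 0
toℚᵘ-ι n = ℚ.toℚᵘ-fromℚᵘ (ℚᵘ.mkℚᵘ (+ n) 0)

ι-+ : ∀ m n → ι (m ℕ.+ n) ≡ ι m + ι n
ι-+ m n = ℚ.toℚᵘ-injective (begin
  ℚ.toℚᵘ (ι (m ℕ.+ n))                          ≈⟨ toℚᵘ-ι (m ℕ.+ n) ⟩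
  ℚᵘ.mkℚᵘ (+ (m ℕ.+ n)) 0                       ≈⟨ ℚᵘ.*≡* (cong (ℤ._* + 1)
                                                     (cong₂ ℤ._+_ (sym (ℤ.*-identityʳ (+ m))) (sym (ℤ.*-identityʳ (+ n))))) ⟩
  ℚᵘ.mkℚᵘ (+ m) 0 ℚᵘ.+ ℚᵘ.mkℚᵘ (+ n) 0          ≈⟨ ℚᵘ.+-cong (toℚᵘ-ι m) (toℚᵘ-ι n) ⟨
  ℚ.toℚᵘ (ι m) ℚᵘ.+ ℚ.toℚᵘ (ι n)                ≈⟨ ℚ.toℚᵘ-homo-+ (ι m) (ι n) ⟨
  ℚ.toℚᵘ (ι m + ι n)                            ∎)
  where open ℚᵘ.≃-Reasoning

ι-* : ∀ m n → ι (m ℕ.* n) ≡ ι m * ι n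
ι-* m n = ℚ.toℚᵘ-injective (begin
  ℚ.toℚᵘ (ι (m ℕ.* n))                          ≈⟨ toℚᵘ-ι (m ℕ.* n) ⟩
  ℚᵘ.mkℚᵘ (+ (m ℕ.* n)) 0                       ≈⟨ ℚᵘ.*≡* (cong (ℤ._* + 1) (ℤ.pos-* m n)) ⟩
  ℚᵘ.mkℚᵘ (+ m) 0 ℚᵘ.* ℚᵘ.mkℚᵘ (+ n) 0          ≈⟨ ℚᵘ.*-cong (toℚᵘ-ι m) (toℚᵘ-ι n) ⟨
  ℚ.toℚᵘ (ι m) ℚᵘ.* ℚ.toℚᵘ (ι n)                ≈⟨ ℚ.toℚᵘ-homo-* (ι m) (ι n) ⟨
  ℚ.toℚᵘ (ι m * ι n)                            ∎)
  where open ℚᵘ.≃-Reasoning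

/2≡½* : ∀ n → (+ n) / 2 ≡ ½ * ι n
/2≡½* n = ℚ.toℚᵘ-injective (begin
  ℚ.toℚᵘ ((+ n) / 2)                            ≈⟨ ℚ.toℚᵘ-fromℚᵘ (ℚᵘ.mkℚᵘ (+ n) 1) ⟩
  ℚᵘ.mkℚᵘ (+ n) 1                               ≈⟨ ℚᵘ.*≡* (cong (ℤ._* + 2) (sym (ℤ.*-identityˡ (+ n)))) ⟩
  ℚᵘ.½ ℚᵘ.* ℚᵘ.mkℚᵘ (+ n) 0                     ≈⟨ ℚᵘ.*-congˡ {ℚᵘ.½} (toℚᵘ-ι n) ⟨
  ℚ.toℚᵘ ½ ℚᵘ.* ℚ.toℚᵘ (ι n)                    ≈⟨ ℚ.toℚᵘ-homo-* ½ (ι n) ⟨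
  ℚ.toℚᵘ (½ * ι n)                              ∎)
  where open ℚᵘ.≃-Reasoning

-- The four sums combine termwise into one; after the first term is split off, the induction
-- continues with the shifted potential `G ∘ suc`.
telescope : ∀ {n} A (f p v g : Fin n → ℚ) (G : ℕ → ℚ) →
  (∀ q → f q - A * (p q - v q) - g q ≡ G (suc (toℕ q)) - G (toℕ q)) →
  Σℚ f - A * (Σℚ p - Σℚ v) - Σℚ g ≡ G n - G 0
telescope {zero} A f p v g G step =
  solve 2 (λ A G₀ → con 0ℚ :- A :* (con 0ℚ :- con 0ℚ) :- con 0ℚ := G₀ :- G₀) refl A (G 0)
telescope {suc n} A f p v g G step = begin
  (f₀ + Σf) - A * ((p₀ + Σp) - (v₀ + Σv)) - (g₀ + Σg)
    ≡⟨ solve 9 (λ A f₀ Σf p₀ Σp v₀ Σv g₀ Σg →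
         (f₀ :+ Σf) :- A :* ((p₀ :+ Σp) :- (v₀ :+ Σv)) :- (g₀ :+ Σg) :=
         (f₀ :- A :* (p₀ :- v₀) :- g₀) :+ (Σf :- A :* (Σp :- Σv) :- Σg)) refl A f₀ Σf p₀ Σp v₀ Σv g₀ Σg ⟩
  (f₀ - A * (p₀ - v₀) - g₀) + (Σf - A * (Σp - Σv) - Σg)
    ≡⟨ cong₂ _+_ (step Fin.zero)
         (telescope A (f ∘ Fin.suc) (p ∘ Fin.suc) (v ∘ Fin.suc) (g ∘ Fin.suc) (G ∘ suc) (step ∘ Fin.suc)) ⟩
  (G 1 - G 0) + (G (suc n) - G 1)
    ≡⟨ solve 3 (λ G₀ G₁ Gₙ → (G₁ :- G₀) :+ (Gₙ :- G₁) := Gₙ :- G₀) refl (G 0) (G 1) (G (suc n)) ⟩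
  G (suc n) - G 0 ∎
  where
  open ≡-Reasoning
  f₀ = f Fin.zero
  p₀ = p Fin.zero
  v₀ = v Fin.zero
  g₀ = g Fin.zero
  Σf = Σℚ (f ∘ Fin.suc)
  Σp = Σℚ (p ∘ Fin.suc)
  Σv = Σℚ (v ∘ Fin.suc)
  Σg = Σℚ (g ∘ Fin.suc)

-- The fence with equal segments: slopes and covers.

module EqualFence (a′ t′ : ℕ) (t′-even : parity t′ ≡ 0ℙ) where

  a t : ℕ
  a = suc a′
  t = suc t′

  module 𝔽 = Fence (replicate t a)
  open 𝔽 using
    ( #F; F; index; _⋖_; Ideal; members; downClosed
    ; _∈max_; _∈max?_; _∈min∁_; _∈min∁?_; Peak; Valley; peak?; valley? )

  #F≡ : #F ≡ a′ ℕ.+ t′ ℕ.* a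
  #F≡ = cong (ℕ._∸ 1) (vecSum-replicate t a)

  a≡ : ∀ {i} → i ≤ t → 𝔽.a i ≡ i ℕ.* a
  a≡ = sum-take-replicate a

  [r+ka]/a : ∀ {r} k → r < a → (r ℕ.+ k ℕ.* a) ℕ./ a ≡ k
  [r+ka]/a {r} k r<a = trans (+-distrib-/-∣ʳ r (n∣m*n k))
    (cong₂ ℕ._+_ (m<n⇒m/n≡0 r<a) (m*n/n≡m k a))

  -- The slope of the edge from x_j to x_{j+1}: 0ℙ if it rises, 1ℙ if it falls.
  slope : ℕ → Parity
  slope j = parity (j ℕ./ a)

  slope-at : ∀ {r} k → r < a → slope (r ℕ.+ k ℕ.* a) ≡ parity k
  slope-at k r<a = cong parity ([r+ka]/a k r<a)

  -- The edge from x_n to the fictitious x_{n+1} continues the last segment, which rises because t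
  -- is odd; this makes X_{n+1} = 0 consistent with down-closure.
  slope-#F : slope #F ≡ 0ℙ
  slope-#F = trans (cong slope #F≡) (trans (slope-at t′ ℕ.≤-refl) t′-even)

  -- Classifies the element x_{i+1} by i = `toℕ q`, not by its index: its edges are i and i + 1.
  -- They share segment k when `interior`, and lie on segments k and k + 1 when `boundary`, where i
  -- + 1 = (k + 1) a.
  data Position : ℕ → Set where
    interior : ∀ r k → suc r < a → Position (r ℕ.+ k ℕ.* a)
    boundary : ∀ k → Position (a′ ℕ.+ k ℕ.* a)

  position : ∀ i → Position i
  position i = subst Position (sym (m≡m%n+[m/n]*n i a)) (by-remainder (i ℕ./ a) (m%n<n i a))
    where
    by-remainder : ∀ {r} k → r < a → Position (r ℕ.+ k ℕ.* a)
    by-remainder {r} k r<a with ℕ.m≤n⇒m<n∨m≡n r<a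
    ... | inj₁ 1+r<a = interior r k 1+r<a
    ... | inj₂ refl  = boundary k

  index<ta : ∀ (q : F) → index q < t ℕ.* a
  index<ta q = s≤s (subst (index q ≤_) #F≡ (toℕ<n q))

  segment : (j : ℕ) → j < t ℕ.* a → Σ[ k ∈ Fin t ] (toℕ k ≡ j ℕ./ a × 𝔽.OnSegment j k)
  segment j j<ta = k , k≡ , lower , upper
    where
    k : Fin t
    k = fromℕ< (m<n*o⇒m/o<n {o = a} j<ta)
    k≡ : toℕ k ≡ j ℕ./ a
    k≡ = toℕ-fromℕ< _
    lower : 𝔽.a (toℕ k) ≤ j
    lower rewrite a≡ (ℕ.<⇒≤ (toℕ<n k)) | k≡ = m/n*n≤m j a
    upper : j < 𝔽.a (suc (toℕ k))
    upper rewrite a≡ (toℕ<n k) | k≡ = begin-strict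
      j                             ≡⟨ m≡m%n+[m/n]*n j a ⟩
      j % a ℕ.+ (j ℕ./ a) ℕ.* a     <⟨ ℕ.+-monoˡ-< _ (m%n<n j a) ⟩
      a ℕ.+ (j ℕ./ a) ℕ.* a         ∎
      where open ℕ.≤-Reasoning

  OnSegment⇒/ : ∀ {j} (k : Fin t) → 𝔽.OnSegment j k → j ℕ./ a ≡ toℕ k
  OnSegment⇒/ {j} k (lower , upper)
    rewrite a≡ (ℕ.<⇒≤ (toℕ<n k)) | a≡ (toℕ<n k) =
    trans (cong (ℕ._/ a) (sym (ℕ.m∸n+n≡m lower))) ([r+ka]/a (toℕ k) r<a)
    where
    r<a : j ℕ.∸ toℕ k ℕ.* a < a
    r<a = ℕ.+-cancelʳ-< (toℕ k ℕ.* a) _ _ (subst (_< a ℕ.+ toℕ k ℕ.* a) (sym (ℕ.m∸n+n≡m lower)) upper)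

  -- `Fence` numbers segments from 1, whereas the quotient by `a` counts from 0; hence the inverted
  -- parity.
  ⋖-rising : ∀ {p q} → index q ≡ suc (index p) → slope (index p) ≡ 0ℙ → p ⋖ q
  ⋖-rising {p} q≡ up with segment (index p) (index<ta p)
  ... | k , k≡ , on = k , inj₁ (trans (parity-suc (toℕ k)) (cong ℙ._⁻¹ (trans (cong parity k≡) up)) , on , q≡)

  ⋖-falling : ∀ {p q} → index p ≡ suc (index q) → slope (index q) ≡ 1ℙ → p ⋖ q
  ⋖-falling {p} {q} p≡ down with segment (index q) (index<ta q)
  ... | k , k≡ , on = k , inj₂ (trans (parity-suc (toℕ k)) (cong ℙ._⁻¹ (trans (cong parity k≡) down)) , on , p≡)

  ⋖-cases : ∀ {p q} → p ⋖ q →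
    (index q ≡ suc (index p) × slope (index p) ≡ 0ℙ) ⊎ (index p ≡ suc (index q) × slope (index q) ≡ 1ℙ)
  ⋖-cases (k , inj₁ (odd , on , q≡)) =
    inj₁ (q≡ , trans (cong parity (OnSegment⇒/ k on)) (trans (sym (ℙ.suc-homo-⁻¹ (toℕ k))) (cong ℙ._⁻¹ odd)))
  ⋖-cases (k , inj₂ (even , on , p≡)) =
    inj₂ (p≡ , trans (cong parity (OnSegment⇒/ k on)) (trans (sym (ℙ.suc-homo-⁻¹ (toℕ k))) (cong ℙ._⁻¹ even)))

  -- Ideals as Boolean sequences along the fence.

  module _ (I : Ideal) where

    mem : ℕ → Bool
    mem zero    = true
    mem (suc j) = at (members I) j

    point : ∀ {j} → j < #F → Σ[ s ∈ F ] j ≡ toℕ s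
    point j<n = fromℕ< j<n , sym (toℕ-fromℕ< j<n)

    -- The edge leaving x_n rises, so an element followed by a falling edge is not the last one.
    after-fall : ∀ {j} → j < #F → slope (suc j) ≡ 1ℙ → suc j < #F
    after-fall j<n down with ℕ.m≤n⇒m<n∨m≡n j<n
    ... | inj₁ 1+j<n = 1+j<n
    ... | inj₂ 1+j≡n with () ← trans (sym down) (trans (cong slope 1+j≡n) slope-#F)

    mem-rising : ∀ j → slope j ≡ 0ℙ → mem (suc j) ≡ true → mem j ≡ true
    mem-rising zero    up y = refl
    mem-rising (suc i) up y with point (at-bounded (members I) (suc i) y)
    ... | s , s≡ with point (ℕ.<-trans ℕ.≤-refl (at-bounded (members I) (suc i) y))
    ... | p , refl = ∈⇒at (downClosed I (p⋖s ◅ ε) (at⇒∈ (subst (λ j → mem (suc j) ≡ true) s≡ y)))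
      where
      p⋖s : p ⋖ s
      p⋖s = ⋖-rising (cong suc (sym s≡)) up

    mem-falling : ∀ j → slope j ≡ 1ℙ → mem j ≡ true → mem (suc j) ≡ true
    -- The case `j = 0` is absurd, since edge 0 rises.
    mem-falling (suc i) down x with point (at-bounded (members I) i x)
    ... | p , refl with point (after-fall (toℕ<n p) down)
    ... | s , s≡ = subst (λ j → mem (suc j) ≡ true) (sym s≡) (∈⇒at (downClosed I (s⋖p ◅ ε) (at⇒∈ x)))
      where
      s⋖p : s ⋖ p
      s⋖p = ⋖-falling (cong suc (sym s≡)) down

    -- The conventions X_0 = 1 and X_{n+1} = 0 make this hold on the two fictitious edges as well,
    -- so the end points need no separate treatment later.
    edge : ∀ j → Edge (slope j) (mem j) (mem (suc j))
    edge j with slope j in sl | mem j in x | mem (suc j) in y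
    ... | _  | true  | true  = both
    ... | _  | false | false = neither
    ... | 0ℙ | true  | false = onlyˡ
    ... | 1ℙ | false | true  = onlyʳ
    ... | 0ℙ | false | true  with () ← trans (sym x) (mem-rising j sl y)
    ... | 1ℙ | true  | false with () ← trans (sym y) (mem-falling j sl x)

    Maximalᵢ Minimal∁ᵢ : ℕ → Set
    Maximalᵢ  i = Maximal  (slope i) (slope (suc i)) (mem i) (mem (suc i)) (mem (suc (suc i)))
    Minimal∁ᵢ i = Minimal∁ (slope i) (slope (suc i)) (mem i) (mem (suc i)) (mem (suc (suc i)))

    -- If a member lies strictly above q, down-closure makes the first element of a chain towards it
    -- a member too; so the neighbours of q decide.
    ∈max⇔ : ∀ q → q ∈max I ⇔ Maximalᵢ (toℕ q)
    ∈max⇔ q = mk⇔ to from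
      where
      to : q ∈max I → Maximalᵢ (toℕ q)
      to (q∈I , top) = ∈⇒at q∈I , right , left (toℕ q) refl
        where
        right : slope (index q) ≡ 0ℙ → mem (suc (index q)) ≡ false
        right up = Bool.¬-not λ z → absurd z (point (at-bounded (members I) _ z))
          where
          absurd : mem (suc (index q)) ≡ true → (Σ[ s ∈ F ] index q ≡ toℕ s) → ⊥
          absurd z (s , s≡) = ℕ.1+n≢n (trans s≡ (cong toℕ (sym q≡s)))
            where
            q≡s : q ≡ s
            q≡s = top s (at⇒∈ (subst (λ j → mem (suc j) ≡ true) s≡ z)) (⋖-rising (cong suc (sym s≡)) up ◅ ε)
        left : ∀ i → i ≡ toℕ q → slope i ≡ 1ℙ → mem i ≡ false
        -- Keeping `i` apart from `toℕ q` allows matching on it; `i = 0` cannot occur, as edge 0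
        -- rises.
        left (suc i) i≡ down = Bool.¬-not λ x → absurd x (point (at-bounded (members I) _ x))
          where
          absurd : mem (suc i) ≡ true → (Σ[ s ∈ F ] i ≡ toℕ s) → ⊥
          absurd x (s , refl) = ℕ.1+n≢n (trans i≡ (cong toℕ (top s (at⇒∈ x) (⋖-falling (cong suc (sym i≡)) down ◅ ε))))
      from : Maximalᵢ (toℕ q) → q ∈max I
      from (y , right , left) = at⇒∈ y , λ r → top
        where
        top : ∀ {r} → r ∈ members I → q 𝔽.≤ r → q ≡ r
        top r∈I ε = refl
        top r∈I (q⋖s ◅ s≤r) with ⋖-cases q⋖s | ∈⇒at (downClosed I s≤r r∈I)
        ... | inj₁ (s≡ , up)   | s∈I with () ← trans (sym (right up)) (trans (cong mem (sym s≡)) s∈I)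
        ... | inj₂ (q≡ , down) | s∈I
          with () ← trans (sym (left (trans (cong slope (ℕ.suc-injective q≡)) down)))
                          (trans (cong mem (ℕ.suc-injective q≡)) s∈I)

    -- Dually, the complement is up-closed. The recursion in `bot` collapses the upper part of the
    -- chain to q, leaving a single cover to refute.
    ∈min∁⇔ : ∀ q → q ∈min∁ I ⇔ Minimal∁ᵢ (toℕ q)
    ∈min∁⇔ q = mk⇔ to from
      where
      to : q ∈min∁ I → Minimal∁ᵢ (toℕ q)
      to (q∉I , bot) = ∉⇒at q∉I , left (toℕ q) refl , right
        where
        right : slope (index q) ≡ 1ℙ → mem (suc (index q)) ≡ true
        right down = Bool.¬-not λ z → absurd z (point (after-fall (toℕ<n q) down))
          where
          absurd : mem (suc (index q)) ≡ false → (Σ[ s ∈ F ] index q ≡ toℕ s) → ⊥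
          absurd z (s , s≡) = ℕ.1+n≢n (trans s≡ (cong toℕ s≡q))
            where
            s≡q : s ≡ q
            s≡q = bot s (at⇒∉ (subst (λ j → mem (suc j) ≡ false) s≡ z)) (⋖-falling (cong suc (sym s≡)) down ◅ ε)
        left : ∀ i → i ≡ toℕ q → slope i ≡ 0ℙ → mem i ≡ true
        -- x_1 has no left neighbour, and X_0 = 1 makes the condition hold.
        left zero    i≡ up = refl
        left (suc i) i≡ up = Bool.¬-not λ x → absurd x (point (ℕ.<⇒≤ (subst (_< #F) (sym i≡) (toℕ<n q))))
          where
          absurd : mem (suc i) ≡ false → (Σ[ s ∈ F ] i ≡ toℕ s) → ⊥
          absurd x (s , refl) = ℕ.1+n≢n (trans i≡ (cong toℕ (sym (bot s (at⇒∉ x) (⋖-rising (cong suc (sym i≡)) up ◅ ε)))))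
      from : Minimal∁ᵢ (toℕ q) → q ∈min∁ I
      from (y , left , right) = at⇒∉ y , λ r → bot
        where
        bot : ∀ {r} → r ∉ members I → r 𝔽.≤ q → r ≡ q
        bot r∉I ε = refl
        bot r∉I (r⋖s ◅ s≤q) with bot (λ s∈I → r∉I (downClosed I (r⋖s ◅ ε) s∈I)) s≤q
        ... | refl with ⋖-cases r⋖s | ∉⇒at r∉I
        ... | inj₂ (r≡ , down) | r∉ with () ← trans (sym (right down)) (trans (cong mem (sym r≡)) r∉)
        ... | inj₁ (q≡ , up)   | r∉
          with () ← trans (sym (left (trans (cong slope (ℕ.suc-injective q≡)) up)))
                          (trans (cong mem (ℕ.suc-injective q≡)) r∉)

    χ̂≡ : ∀ q → 𝔽.χ̂ q I ≡ bit (mem (index q))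
    χ̂≡ q = cong bit (at-∈? q (members I))

    maxᵢ? : ∀ i → Dec (Maximalᵢ i)
    maxᵢ? i = maximal? (slope i) (slope (suc i)) (mem i) (mem (suc i)) (mem (suc (suc i)))

    χᵢ Tᵢ : ℕ → ℚ
    χᵢ i = bit (does (maxᵢ? i))
    Tᵢ i = toggle (slope i) (slope (suc i)) (mem i) (mem (suc i)) (mem (suc (suc i)))

    χ≡ : ∀ q → 𝔽.χ q I ≡ χᵢ (toℕ q)
    χ≡ q = cong bit (does-⇔ (∈max⇔ q) (q ∈max? I) (maxᵢ? (toℕ q)))

    T≡ : ∀ q → 𝔽.T q I ≡ Tᵢ (toℕ q)
    T≡ q = cong₂ (λ b c → if b then 1ℚ else if c then - 1ℚ else 0ℚ)
      (does-⇔ (∈min∁⇔ q) (q ∈min∁? I)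
        (minimal∁? (slope (toℕ q)) (slope (index q)) (mem (toℕ q)) (mem (index q)) (mem (suc (index q)))))
      (does-⇔ (∈max⇔ q) (q ∈max? I) (maxᵢ? (toℕ q)))

  -- Slopes at peaks and valleys.

  slope-suc-interior : ∀ {r} k → suc r < a → slope (r ℕ.+ k ℕ.* a) ≡ slope (suc (r ℕ.+ k ℕ.* a))
  slope-suc-interior k 1+r<a = trans (slope-at k (ℕ.<⇒≤ 1+r<a)) (sym (slope-at k 1+r<a))

  slope-boundary : ∀ k → slope (a′ ℕ.+ k ℕ.* a) ≡ parity k
  slope-boundary k = slope-at k ℕ.≤-refl

  slope-suc-boundary : ∀ k → slope (suc (a′ ℕ.+ k ℕ.* a)) ≡ parity k ℙ.⁻¹
  slope-suc-boundary k = trans (slope-at (suc k) (s≤s z≤n)) (parity-suc k)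

  turning-slopes : ∀ {q : F} (i : Fin t) → 1 ≤ toℕ i → index q ≡ 𝔽.a (toℕ i) →
    slope (toℕ q) ≡ parity (toℕ i) ℙ.⁻¹ × slope (index q) ≡ parity (toℕ i)
  turning-slopes {q} (Fin.suc m) _ q≡ =
    trans (cong slope (ℕ.suc-injective q≡a)) (trans (slope-boundary (toℕ m)) (sym (ℙ.suc-homo-⁻¹ (toℕ m)))) ,
    trans (cong slope q≡a) (slope-at (suc (toℕ m)) (s≤s z≤n))
    where
    q≡a : index q ≡ suc (toℕ m) ℕ.* a
    q≡a = trans q≡ (a≡ (ℕ.<⇒≤ (toℕ<n (Fin.suc m))))

  turning-index : ∀ {q : F} k → toℕ q ≡ a′ ℕ.+ k ℕ.* a →
    Σ[ i ∈ Fin t ] (toℕ i ≡ suc k × index q ≡ 𝔽.a (toℕ i))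
  turning-index {q} k q≡ = i , i≡ ,
    trans (cong suc q≡) (trans (cong (ℕ._* a) (sym i≡)) (sym (a≡ (ℕ.<⇒≤ (toℕ<n i)))))
    where
    -- Here (k + 1) a = `index q` < t a, so k + 1 is an admissible turning-point number.
    1+k<t : suc k < t
    1+k<t = ℕ.*-cancelʳ-< a (suc k) t (subst (_< t ℕ.* a) (cong suc q≡) (index<ta q))
    i : Fin t
    i = fromℕ< 1+k<t
    i≡ : toℕ i ≡ suc k
    i≡ = toℕ-fromℕ< 1+k<t

  -- Serves to rule out peaks where the slopes do not fit, as `valley-slopes` does for valleys;
  -- `peak-at` and `valley-at` produce them at the multiples of a.
  peak-slopes : ∀ {q} → Peak q → slope (toℕ q) ≡ 0ℙ × slope (index q) ≡ 1ℙ
  peak-slopes {q} (i , 1≤i , odd , q≡) with u , v ← turning-slopes {q} i 1≤i q≡ =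
    trans u (cong ℙ._⁻¹ odd) , trans v odd

  valley-slopes : ∀ {q} → Valley q → slope (toℕ q) ≡ 1ℙ × slope (index q) ≡ 0ℙ
  valley-slopes {q} (i , 1≤i , even , q≡) with u , v ← turning-slopes {q} i 1≤i q≡ =
    trans u (cong ℙ._⁻¹ even) , trans v even

  peak-at : ∀ {q} k → toℕ q ≡ a′ ℕ.+ k ℕ.* a → parity k ≡ 0ℙ → Peak q
  peak-at {q} k q≡ even with i , i≡ , qi ← turning-index {q} k q≡ =
    i , subst (1 ≤_) (sym i≡) (s≤s z≤n) ,
    trans (cong parity i≡) (trans (parity-suc k) (cong ℙ._⁻¹ even)) , qi

  valley-at : ∀ {q} k → toℕ q ≡ a′ ℕ.+ k ℕ.* a → parity k ≡ 1ℙ → Valley q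
  valley-at {q} k q≡ odd with i , i≡ , qi ← turning-index {q} k q≡ =
    i , subst (1 ≤_) (sym i≡) (s≤s z≤n) ,
    trans (cong parity i≡) (trans (parity-suc k) (cong ℙ._⁻¹ odd)) , qi

  -- The coefficients and the Wronskian.

  A : ℚ
  A = ι a

  δ : ℕ → ℚ
  δ r = - ½ * (ι r * (A - ι r))

  D : ℕ → ℚ
  D j = δ (j % a)

  δ-a : δ a ≡ 0ℚ
  δ-a = solve 1 (λ A → con (- ½) :* (A :* (A :- A)) := con 0ℚ) refl A

  δ-0 : δ 0 ≡ 0ℚ
  δ-0 = solve 1 (λ A → con (- ½) :* (con 0ℚ :* (A :- con 0ℚ)) := con 0ℚ) refl A

  -- The endpoint r = a is allowed because δ vanishes at both 0 and a; second differences can thus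
  -- reach the next multiple of a in one formula.
  D-at : ∀ {r} k → r ≤ a → D (r ℕ.+ k ℕ.* a) ≡ δ r
  D-at {r} k r≤a with ℕ.m≤n⇒m<n∨m≡n r≤a
  ... | inj₁ r<a  = cong δ (trans ([m+kn]%n≡m%n r k a) (m<n⇒m%n≡m r<a))
  ... | inj₂ refl = trans (cong δ ([m+kn]%n≡m%n 0 (suc k) a)) (trans δ-0 (sym δ-a))

  -- At peaks D vanishes.
  coefficient : F → ℚ
  coefficient q = if does (valley? q) then - A else D (index q)

  -- Counts the valleys among x_1, ..., x_j, which are the multiples of 2a. In `wronskian` the
  -- summand `A * v` accumulates the extra a contributed by each.
  valleys : ℕ → ℚ
  valleys j = ι ⌊ (j ℕ./ a) /2⌋

  wronskian : (x y d e v : ℚ) → ℚ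
  wronskian x y d e v = x * e - d * y + A * v

  -- One element's contribution, with the peak and valley tests as Booleans so that the conditionals
  -- compute once these are known.
  term : (p v : Bool) (y χ d T : ℚ) → ℚ
  term p v y χ d T =
    y - A * ((if p then χ else 0ℚ) - (if v then χ else 0ℚ)) - (if v then - A else d) * T

  term-cong : ∀ {p p′ v v′ y y′ χ χ′ d d′ T T′} →
    p ≡ p′ → v ≡ v′ → y ≡ y′ → χ ≡ χ′ → d ≡ d′ → T ≡ T′ → term p v y χ d T ≡ term p′ v′ y′ χ′ d′ T′
  term-cong refl refl refl refl refl refl = refl

  wronskian-cong : ∀ x y {d d′ e e′ v v′} → d ≡ d′ → e ≡ e′ → v ≡ v′ →
    wronskian x y d e v ≡ wronskian x y d′ e′ v′
  wronskian-cong x y refl refl refl = refl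

  -- The increment at each element and its total.

  module _ (I : Ideal) where

    private
      X : ℕ → ℚ
      X j = bit (mem I j)

    G : ℕ → ℚ
    G j = wronskian (X j) (X (suc j)) (D j) (D (suc j)) (valleys j)

    step-at : ∀ {i} → Position i → (q : F) → toℕ q ≡ i →
      term (does (peak? q)) (does (valley? q)) (X (suc i)) (χᵢ I i) (D (suc i)) (Tᵢ I i) ≡ G (suc i) - G i
    step-at (interior r k 1+r<a) q q≡ = begin
      term (does (peak? q)) (does (valley? q)) y (χᵢ I i) (D (suc i)) (Tᵢ I i)
        ≡⟨ term-cong (dec-false (peak? q) ¬peak) (dec-false (valley? q) ¬valley)
             (refl {x = y}) (refl {x = χᵢ I i})
             (trans D₁ δ₁) (toggle-interior (slope-suc-interior k 1+r<a) (edge I i) (edge I (suc i))) ⟩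
      y - A * (0ℚ - 0ℚ) - d (1ℚ + ρ) * (x - (1ℚ + 1ℚ) * y + z)
        -- The increment is y Δ²D - D Δ²X, and the quadratic `d` has second difference 1.
        ≡⟨ solve 6 (λ x y z r A V → let d = λ s → con (- ½) :* (s :* (A :- s)) in
             y :- A :* (con 0ℚ :- con 0ℚ) :- d (con 1ℚ :+ r) :* (x :- (con 1ℚ :+ con 1ℚ) :* y :+ z) :=
             (y :* d (con 1ℚ :+ (con 1ℚ :+ r)) :- d (con 1ℚ :+ r) :* z :+ A :* V) :-
             (x :* d (con 1ℚ :+ r) :- d r :* y :+ A :* V)) refl x y z ρ A (ι ⌊ k /2⌋) ⟩
      wronskian y z (d (1ℚ + ρ)) (d (1ℚ + (1ℚ + ρ))) (ι ⌊ k /2⌋) - wronskian x y (d ρ) (d (1ℚ + ρ)) (ι ⌊ k /2⌋)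
        ≡⟨ cong₂ _-_ (wronskian-cong y z (trans D₁ δ₁) (trans D₂ δ₂) V₁) (wronskian-cong x y D₀ (trans D₁ δ₁) V₀) ⟨
      G (suc i) - G i ∎
      where
      open ≡-Reasoning
      i : ℕ
      i = r ℕ.+ k ℕ.* a
      x y z ρ : ℚ
      x = X i
      y = X (suc i)
      z = X (suc (suc i))
      ρ = ι r
      d : ℚ → ℚ
      d s = - ½ * (s * (A - s))
      r<a : r < a
      r<a = ℕ.<⇒≤ 1+r<a
      D₀ : D i ≡ d ρ
      D₀ = D-at k (ℕ.<⇒≤ r<a)
      D₁ : D (suc i) ≡ δ (suc r)
      D₁ = D-at k r<a
      D₂ : D (suc (suc i)) ≡ δ (suc (suc r))
      D₂ = D-at k 1+r<a
      δ₁ : δ (suc r) ≡ d (1ℚ + ρ)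
      δ₁ = cong d (ι-+ 1 r)
      δ₂ : δ (suc (suc r)) ≡ d (1ℚ + (1ℚ + ρ))
      δ₂ = cong d (trans (ι-+ 1 (suc r)) (cong (λ s → 1ℚ + s) (ι-+ 1 r)))
      V₀ : valleys i ≡ ι ⌊ k /2⌋
      V₀ = cong (λ j → ι ⌊ j /2⌋) ([r+ka]/a k r<a)
      V₁ : valleys (suc i) ≡ ι ⌊ k /2⌋
      V₁ = cong (λ j → ι ⌊ j /2⌋) ([r+ka]/a k 1+r<a)
      slopes : slope (toℕ q) ≡ slope (index q)
      slopes = subst (λ j → slope j ≡ slope (suc j)) (sym q≡) (slope-suc-interior k 1+r<a)
      ¬peak : Peak q → ⊥
      ¬peak peak with u , v ← peak-slopes {q} peak with () ← trans (sym u) (trans slopes v)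
      ¬valley : Valley q → ⊥
      ¬valley valley with u , v ← valley-slopes {q} valley with () ← trans (sym u) (trans slopes v)
    step-at (boundary k) q q≡ = by-parity (parity k) refl
      where
      open ≡-Reasoning
      i h : ℕ
      i = a′ ℕ.+ k ℕ.* a
      h = ⌊ k /2⌋
      x y z α : ℚ
      x = X i
      y = X (suc i)
      z = X (suc (suc i))
      α = ι a′
      -- The left neighbour has residue a - 1 = a′, so the ring identities below are stated in α,
      -- with 1 + α for A.
      A≡ : A ≡ 1ℚ + α
      A≡ = ι-+ 1 a′
      d : ℚ → ℚ
      d s = - ½ * (s * ((1ℚ + α) - s))
      δ≡ : ∀ r → δ r ≡ d (ι r)
      δ≡ r = cong (λ A → - ½ * (ι r * (A - ι r))) A≡
      D₀ : D i ≡ d α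
      D₀ = trans (D-at k (ℕ.n≤1+n a′)) (δ≡ a′)
      D₁ : D (suc i) ≡ 0ℚ
      D₁ = trans (D-at k ℕ.≤-refl) δ-a
      D₂ : D (suc (suc i)) ≡ d 1ℚ
      D₂ = trans (D-at (suc k) (s≤s z≤n)) (δ≡ 1)
      V₀ : valleys i ≡ ι h
      V₀ = cong (λ j → ι ⌊ j /2⌋) ([r+ka]/a k ℕ.≤-refl)
      V₁ : valleys (suc i) ≡ ι ⌊ suc k /2⌋
      V₁ = cong (λ j → ι ⌊ j /2⌋) ([r+ka]/a (suc k) (s≤s z≤n))
      ΔG : G (suc i) - G i ≡ wronskian y z 0ℚ (d 1ℚ) (ι ⌊ suc k /2⌋) - wronskian x y (d α) 0ℚ (ι h)
      ΔG = cong₂ _-_ (wronskian-cong y z D₁ D₂ V₁) (wronskian-cong x y D₀ D₁ V₀)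
      by-parity : ∀ π → parity k ≡ π →
        term (does (peak? q)) (does (valley? q)) y (χᵢ I i) (D (suc i)) (Tᵢ I i) ≡ G (suc i) - G i
      by-parity 0ℙ even = begin
        term (does (peak? q)) (does (valley? q)) y (χᵢ I i) (D (suc i)) (Tᵢ I i)
          ≡⟨ term-cong (dec-true (peak? q) (peak-at {q} k q≡ even)) (dec-false (valley? q) ¬valley)
               (refl {x = y}) (maximal-peak u v (edge I i) (edge I (suc i))) D₁ (refl {x = Tᵢ I i}) ⟩
        y - A * (y - 0ℚ) - 0ℚ * Tᵢ I i
          ≡⟨ cong (λ A → y - A * (y - 0ℚ) - 0ℚ * Tᵢ I i) A≡ ⟩
        y - (1ℚ + α) * (y - 0ℚ) - 0ℚ * Tᵢ I i
          -- Both sides equal -α y: at a multiple of a, D vanishes and Δ²D = 1 - a.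
          ≡⟨ solve 6 (λ x y z α V T → let A = con 1ℚ :+ α ; d = λ s → con (- ½) :* (s :* (A :- s)) in
               y :- A :* (y :- con 0ℚ) :- con 0ℚ :* T :=
               (y :* d (con 1ℚ) :- con 0ℚ :* z :+ A :* V) :- (x :* con 0ℚ :- d α :* y :+ A :* V)) refl
               x y z α (ι h) (Tᵢ I i) ⟩
        (y * d 1ℚ - 0ℚ * z + (1ℚ + α) * ι h) - (x * 0ℚ - d α * y + (1ℚ + α) * ι h)
          ≡⟨ cong₂ (λ A h′ → (y * d 1ℚ - 0ℚ * z + A * ι h′) - (x * 0ℚ - d α * y + A * ι h)) A≡ (⌊suc/2⌋-even k even) ⟨
        wronskian y z 0ℚ (d 1ℚ) (ι ⌊ suc k /2⌋) - wronskian x y (d α) 0ℚ (ι h)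
          ≡⟨ ΔG ⟨
        G (suc i) - G i ∎
        where
        u : slope i ≡ 0ℙ
        u = trans (slope-boundary k) even
        v : slope (suc i) ≡ 1ℙ
        v = trans (slope-suc-boundary k) (cong ℙ._⁻¹ even)
        ¬valley : Valley q → ⊥
        ¬valley valley with () ← trans (sym (proj₁ (valley-slopes {q} valley))) (trans (cong slope q≡) u)
      by-parity 1ℙ odd = begin
        term (does (peak? q)) (does (valley? q)) y χ (D (suc i)) (Tᵢ I i)
          ≡⟨ term-cong (dec-false (peak? q) ¬peak) (dec-true (valley? q) (valley-at {q} k q≡ odd))
               (refl {x = y}) (refl {x = χ}) D₁ (toggle-valley u v (edge I i) (edge I (suc i))) ⟩
        y - A * (0ℚ - χ) - (- A) * (1ℚ - y - χ)
          ≡⟨ cong (λ A → y - A * (0ℚ - χ) - (- A) * (1ℚ - y - χ)) A≡ ⟩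
        y - (1ℚ + α) * (0ℚ - χ) - (- (1ℚ + α)) * (1ℚ - y - χ)
          -- With coefficient -A the χ terms cancel. What remains is -α y + A, and A is the jump of
          -- the valley count times A.
          ≡⟨ solve 6 (λ x y z α V χ → let A = con 1ℚ :+ α ; d = λ s → con (- ½) :* (s :* (A :- s)) in
               y :- A :* (con 0ℚ :- χ) :- (:- A) :* (con 1ℚ :- y :- χ) :=
               (y :* d (con 1ℚ) :- con 0ℚ :* z :+ A :* (con 1ℚ :+ V)) :- (x :* con 0ℚ :- d α :* y :+ A :* V)) refl
               x y z α (ι h) χ ⟩
        (y * d 1ℚ - 0ℚ * z + (1ℚ + α) * (1ℚ + ι h)) - (x * 0ℚ - d α * y + (1ℚ + α) * ι h)
          ≡⟨ cong₂ (λ A V → (y * d 1ℚ - 0ℚ * z + A * V) - (x * 0ℚ - d α * y + A * ι h)) A≡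
               (trans (cong ι (⌊suc/2⌋-odd k odd)) (ι-+ 1 h)) ⟨
        wronskian y z 0ℚ (d 1ℚ) (ι ⌊ suc k /2⌋) - wronskian x y (d α) 0ℚ (ι h)
          ≡⟨ ΔG ⟨
        G (suc i) - G i ∎
        where
        χ : ℚ
        χ = χᵢ I i
        u : slope i ≡ 1ℙ
        u = trans (slope-boundary k) odd
        v : slope (suc i) ≡ 0ℙ
        v = trans (slope-suc-boundary k) (cong ℙ._⁻¹ odd)
        ¬peak : Peak q → ⊥
        ¬peak peak with () ← trans (sym (proj₁ (peak-slopes {q} peak))) (trans (cong slope q≡) u)

    step : ∀ q →
      term (does (peak? q)) (does (valley? q)) (𝔽.χ̂ q I) (𝔽.χ q I) (D (index q)) (𝔽.T q I) ≡
      G (suc (toℕ q)) - G (toℕ q)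
    step q = trans
      (term-cong {p = does (peak? q)} {v = does (valley? q)} refl refl (χ̂≡ I q) (χ≡ I q) refl (T≡ I q))
      (step-at (position (toℕ q)) q refl)

    -- Since D_0 = D_{n+1} = X_{n+1} = 0 and X_0 = 1, what remains is a (t - 1)/2 - D_1 = a (t -
    -- 1)/2 + (a - 1)/2 = (t a - 1)/2.
    G-total : G #F - G 0 ≡ (+ #F) / 2
    G-total = begin
      G #F - G 0
        ≡⟨ cong₂ _-_
             (trans (cong (λ b → wronskian (X #F) (bit b) (D #F) (D (suc #F)) (valleys #F)) (at-beyond (members I)))
               (wronskian-cong (X #F) 0ℚ {d = D #F} refl D-end V-end))
             (wronskian-cong 1ℚ (X 1) {v = 0ℚ} δ-0 (D-at {1} 0 (s≤s z≤n)) refl) ⟩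
      wronskian (X #F) 0ℚ (D #F) 0ℚ H - wronskian 1ℚ (X 1) 0ℚ (δ 1) 0ℚ
        ≡⟨ cong (λ A → (X #F * 0ℚ - D #F * 0ℚ + A * H) - (1ℚ * (- ½ * (1ℚ * (A - 1ℚ))) - 0ℚ * X 1 + A * 0ℚ)) (ι-+ 1 a′) ⟩
      (X #F * 0ℚ - D #F * 0ℚ + (1ℚ + α) * H) - (1ℚ * (- ½ * (1ℚ * ((1ℚ + α) - 1ℚ))) - 0ℚ * X 1 + (1ℚ + α) * 0ℚ)
        ≡⟨ solve 5 (λ x d y α H → let A = con 1ℚ :+ α in
             (x :* con 0ℚ :- d :* con 0ℚ :+ A :* H) :-
             (con 1ℚ :* (con (- ½) :* (con 1ℚ :* (A :- con 1ℚ))) :- con 0ℚ :* y :+ A :* con 0ℚ) :=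
             con ½ :* (α :+ (H :+ H) :* A)) refl (X #F) (D #F) (X 1) α H ⟩
      ½ * (α + (H + H) * (1ℚ + α))
        ≡⟨ cong (½ *_) ι#F ⟨
      ½ * ι #F
        ≡⟨ /2≡½* #F ⟨
      (+ #F) / 2 ∎
      where
      open ≡-Reasoning
      α H : ℚ
      α = ι a′
      H = ι ⌊ t′ /2⌋
      D-end : D (suc #F) ≡ 0ℚ
      D-end = trans (cong (D ∘ suc) #F≡) (trans (D-at t′ ℕ.≤-refl) δ-a)
      V-end : valleys #F ≡ H
      V-end = cong (λ j → ι ⌊ j /2⌋) (trans (cong (ℕ._/ a) #F≡) ([r+ka]/a t′ ℕ.≤-refl))
      ι#F : ι #F ≡ α + (H + H) * (1ℚ + α)
      ι#F = begin
        ι #F                       ≡⟨ cong ι #F≡ ⟩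
        ι (a′ ℕ.+ t′ ℕ.* a)        ≡⟨ ι-+ a′ (t′ ℕ.* a) ⟩
        α + ι (t′ ℕ.* a)           ≡⟨ cong (λ s → α + s) (ι-* t′ a) ⟩
        α + ι t′ * A               ≡⟨ cong₂ (λ s A → α + s * A)
                                        (trans (cong ι (even⇒≡⌊/2⌋+⌊/2⌋ t′ t′-even)) (ι-+ ⌊ t′ /2⌋ ⌊ t′ /2⌋))
                                        (ι-+ 1 a′) ⟩
        α + (H + H) * (1ℚ + α)     ∎

  cardinality-≋ : 𝔽.cardinality 𝔽.≋ (λ I → (+ #F) / 2 + A * (𝔽.Σpeak 𝔽.χ I - 𝔽.Σvalley 𝔽.χ I))
  cardinality-≋ = coefficient , λ I →
    let C = 𝔽.cardinality I
        R = A * (𝔽.Σpeak 𝔽.χ I - 𝔽.Σvalley 𝔽.χ I)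
        S = Σℚ (λ q → coefficient q * 𝔽.T q I)
        C-R-S≡n/2 : C - R - S ≡ (+ #F) / 2
        C-R-S≡n/2 = trans
          (telescope A (λ q → 𝔽.χ̂ q I) (λ q → if does (peak? q) then 𝔽.χ q I else 0ℚ)
            (λ q → if does (valley? q) then 𝔽.χ q I else 0ℚ) (λ q → coefficient q * 𝔽.T q I) (G I) (step I))
          (G-total I)
    -- Replacing n/2 by C - R - S turns the goal into a ring identity.
    in trans (cong (λ N → C - (N + R)) (sym C-R-S≡n/2))
         (solve 3 (λ C R S → C :- ((C :- R :- S) :+ R) := S) refl C R S)

theorem5p3 : (a t : ℕ) → 2 ≤ a → 3 ≤ t → parity t ≡ 1ℙ →
    let module 𝔽 = Fence (replicate t a) in
    𝔽.cardinality 𝔽.≋ (λ I → (+ 𝔽.#F) / 2 + ((+ a) / 1) * (𝔽.Σpeak 𝔽.χ I - 𝔽.Σvalley 𝔽.χ I))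
theorem5p3 (suc a′) (suc t′) _ _ t-odd =
  EqualFence.cardinality-≋ a′ t′ (trans (sym (ℙ.suc-homo-⁻¹ t′)) (cong ℙ._⁻¹ t-odd))
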